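{- Let $G$ be a graph. Then $\mathsf{tree}\text{ - }\alpha(G)\le 1$ if and only if $G$ is chordal.
   Context: All graphs are finite, simple, and undirected. A graph is chordal if it has no induced cycles of length at least four. A tree decomposition of a graph $G$ is a pair $\mathcal{T}=(T,\{X_t\}_{t\in V(T)})$ where $T$ is a tree and each node $t$ is assigned a bag $X_t\subseteq V(G)$ such that every vertex of $G$ is in at least one bag, every edge of $G$ has both endpoints in some common bag, and for every $u\in V(G)$ the subgraph of $T$ induced by $\{t: u\in X_t\}$ is connected. The independence number of $\mathcal{T}$ is $\alpha(\mathcal{T})=\max_{t\in V(T)}\alpha(G[X_t])$, where $\alpha(H)$ is the maximum size of an independent set in $H$. The tree-independence number $\mathsf{tree}\text{ - }\alpha(G)$ is the minimum of $\alpha(\mathcal{T})$ over all tree decompositions $\mathcal{T}$ of $G$. -}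

module Defs where

open import Data.Bool using (true; false)
open import Data.Empty using (⊥)
open import Data.Fin using (Fin; zero; suc; toℕ)
open import Data.Fin.Properties using (all?)
open import Data.Fin.Subset using (Subset; _∈_; ∣_∣; ⊤)
open import Data.Fin.Subset.Properties using (_∈?_; _⊆?_; ∈⊤)
open import Data.List using (List; []; _∷_; _++_; map; filter; allFin)
open import Data.List.Extrema.Nat using (max)
open import Data.Nat using (ℕ; zero; suc; _≤_; s≤s)
open import Data.Nat.Induction using (<-rec)
open import Data.Nat.Properties using (≤-antisym; ≮⇒≥)
open import Data.Product using (Σ; ∃; _×_; _,_)
open import Data.Sum using (_⊎_; inj₁)
open import Data.Vec using ([]; _∷_)
open import Function.Definitions using (Injective)
open import Level using (0ℓ)
open import Relation.Binary.Construct.Closure.ReflexiveTransitive using (Star; ε)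
open import Relation.Binary.Core using (Rel)
open import Relation.Binary.Definitions using (Symmetric; Decidable)
open import Relation.Binary.PropositionalEquality using (_≡_; refl)
open import Relation.Nullary using (¬_; Dec; no)
open import Relation.Nullary.Decidable using (_×-dec_; _→-dec_; ¬?)
open import Relation.Unary using (Pred)

record Graph (n : ℕ) : Set₁ where
  infix 4 _~_ _~?_
  field
    _~_    : Rel (Fin n) 0ℓ
    ~-sym  : Symmetric _~_
    irrefl : ∀ v → ¬ (v ~ v)
    _~?_   : Decidable _~_

-- j is the successor of i in the cyclic order 0, 1, …, k-1, 0.
Next : ∀ {k} → Rel (Fin k) 0ℓ
Next {k} i j = (toℕ j ≡ suc (toℕ i)) ⊎ (suc (toℕ i) ≡ k × toℕ j ≡ 0)

Consecutive : ∀ {k} → Rel (Fin k) 0ℓ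
Consecutive i j = Next i j ⊎ Next j i

record Cycle {n} (G : Graph n) (k : ℕ) : Set where
  open Graph G
  field
    3≤k    : 3 ≤ k
    vertex : Fin k → Fin n
    inj    : Injective _≡_ _≡_ vertex
    edges  : ∀ i j → Consecutive i j → vertex i ~ vertex j

Induced : ∀ {n} {G : Graph n} {k} → Cycle G k → Set
Induced {G = G} C = ∀ i j → vertex i ~ vertex j → Consecutive i j
  where open Graph G
        open Cycle C

Chordal : ∀ {n} → Graph n → Set
Chordal G = ∀ k → 4 ≤ k → (C : Cycle G k) → ¬ Induced C

-- Any two vertices satisfying P are joined by a walk all of whose vertices
-- satisfy P; the case where P is empty is allowed.
ConnectedOn : ∀ {n} → Graph n → Pred (Fin n) 0ℓ → Set
ConnectedOn G P = ∀ s t → P s → P t → Star (λ a b → P a × P b × a ~ b) s t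
  where open Graph G

record IsTree {m} (T : Graph m) : Set where
  open Graph T
  field
    nonempty  : Fin m
    connected : ∀ s t → Star _~_ s t
    acyclic   : ∀ k → ¬ Cycle T k

record TreeDecomposition {n} (G : Graph n) : Set₁ where
  open Graph G
  field
    {m}     : ℕ
    tree    : Graph m
    isTree  : IsTree tree
    bag     : Fin m → Subset n
    covers  : ∀ u → ∃ λ t → u ∈ bag t
    edges   : ∀ u v → u ~ v → ∃ λ t → u ∈ bag t × v ∈ bag t
    subtree : ∀ u → ConnectedOn tree (λ t → u ∈ bag t)

Independent : ∀ {n} → Graph n → Subset n → Set
Independent G S = ∀ u → u ∈ S → ∀ v → v ∈ S → ¬ (u ~ v)
  where open Graph G

independent? : ∀ {n} (G : Graph n) (S : Subset n) → Dec (Independent G S)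
independent? G S =
  all? λ u → (u ∈? S) →-dec all? λ v → (v ∈? S) →-dec ¬? (u ~? v)
  where open Graph G

subsets : ∀ n → List (Subset n)
subsets zero    = [] ∷ []
subsets (suc n) = map (false ∷_) (subsets n) ++ map (true ∷_) (subsets n)

-- α(G[X]).  The independent sets of G[X] are the independent sets of G contained
-- in X; the default value 0 is the size of the empty one.
α[_,_] : ∀ {n} → Graph n → Subset n → ℕ
α[_,_] {n} G X =
  max 0 (map ∣_∣ (filter (λ S → (S ⊆? X) ×-dec independent? G S) (subsets n)))

α : ∀ {n} {G : Graph n} → TreeDecomposition G → ℕ
α {G = G} 𝒯 = max 0 (map (λ t → α[ G , bag t ]) (allFin m))
  where open TreeDecomposition 𝒯

record IsMinimum {ℓ} (P : Pred ℕ ℓ) (k : ℕ) : Set ℓ where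
  field
    attained : P k
    least    : ∀ j → P j → k ≤ j

-- k = tree-α(G).  The minimum ranges over an infinite family of decompositions,
-- so it is given by its graph; IsTreeα-unique and ¬¬∃IsTreeα below show that
-- exactly one k qualifies, classically.
IsTreeα : ∀ {n} → Graph n → ℕ → Set₁
IsTreeα G = IsMinimum (λ j → Σ (TreeDecomposition G) λ 𝒯 → α 𝒯 ≡ j)

IsTreeα-unique : ∀ {n} {G : Graph n} {j k} → IsTreeα G j → IsTreeα G k → j ≡ k
IsTreeα-unique p q =
  ≤-antisym (least p _ (attained q)) (least q _ (attained p))
  where open IsMinimum

trivialDecomposition : ∀ {n} (G : Graph n) → TreeDecomposition G
trivialDecomposition G = record
  { tree    = K₁
  ; isTree  = record
    { nonempty  = zero
    ; connected = λ { zero zero → ε }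
    ; acyclic   = λ { _ record { 3≤k = s≤s (s≤s _) ; edges = e } →
                        e zero (suc zero) (inj₁ (inj₁ refl)) }
    }
  ; bag     = λ _ → ⊤
  ; covers  = λ _ → zero , ∈⊤
  ; edges   = λ _ _ _ → zero , ∈⊤ , ∈⊤
  ; subtree = λ { _ zero zero _ _ → ε }
  }
  where
  K₁ : Graph 1
  K₁ = record
    { _~_    = λ _ _ → ⊥
    ; ~-sym  = λ ()
    ; irrefl = λ _ ()
    ; _~?_   = λ _ _ → no λ ()
    }

¬¬∃IsTreeα : ∀ {n} (G : Graph n) → ¬ ¬ ∃ (IsTreeα G)
¬¬∃IsTreeα G none = empty _ (trivialDecomposition G , refl)
  where
  P : Pred ℕ _
  P j = Σ (TreeDecomposition G) λ 𝒯 → α 𝒯 ≡ j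

  empty : ∀ j → ¬ P j
  empty = <-rec (λ j → ¬ P j) λ j rec Pj →
    none (j , record { attained = Pj ; least = λ i Pi → ≮⇒≥ λ i<j → rec i<j Pi })

{-# OPTIONS --safe #-}
module Submission where

-- A tree decomposition has α ≤ 1 exactly when its bags are cliques.  If the bags are cliques,
-- the bags of the vertices of an induced cycle of length ≥ 4 would close up around an edge of
-- the tree, but in a tree every edge is a bridge.  Conversely, a chordal graph has a simplicial
-- vertex s (Dirac), and a clique tree of G − s extends to G by a leaf with bag N[s].
-- Cycles are obtained, in both directions, by closing an induced path of G − uv with the edge uv.

open import Defs
open import Data.Bool using (true; false)
open import Data.Empty using () renaming (⊥ to ⊥₀)
open import Data.Fin using (Fin; zero; suc; toℕ; fromℕ; fromℕ<; inject₁)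
open import Data.Fin.Properties using (_≟_; all?; any?; toℕ-injective; toℕ-fromℕ; toℕ-fromℕ<; toℕ-inject₁; toℕ<n)
open import Data.Fin.Subset using (Subset; _∈_; _∉_; _⊆_; _⊂_; _∪_; ⁅_⁆; ∣_∣; ⊤; ⊥)
open import Data.Fin.Subset.Induction using (⊂-wellFounded)
open import Data.Fin.Subset.Properties using (_∈?_; _⊆?_; ∈⊤; ∉⊥; nonempty?; x∈⁅x⁆; x∈⁅y⁆⇒x≡y; x∈p∪q⁺; x∈p∪q⁻; p⊆p∪q; ∣⁅x⁆∣≡1; p⊆q⇒∣p∣≤∣q∣; p⊂q⇒∣p∣<∣q∣; Empty-unique; ∣⊥∣≡0)
open import Data.List using (List; []; _∷_; length; lookup; allFin)
open import Data.List.Extrema.Nat using (max≤v⁺; xs≤max)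
open import Data.List.Membership.Propositional using () renaming (_∈_ to _∈ˡ_)
open import Data.List.Membership.Propositional.Properties using (∈-lookup; ∈-map⁺; ∈-++⁺ˡ; ∈-++⁺ʳ; ∈-filter⁺; ∈-allFin)
open import Data.List.Relation.Unary.All as All using (All; []; _∷_)
open import Data.List.Relation.Unary.All.Properties using (¬Any⇒All¬; all-filter) renaming (map⁺ to All-map⁺)
open import Data.List.Relation.Unary.Any as Any using (Any; here; there)
open import Data.Nat using (ℕ; zero; suc; _≤_; _<_; z≤n; s≤s)
open import Data.Nat.Properties as ℕ using (≤-trans; ≤-reflexive; <-trans; n<1+n; <⇒≱)
open import Data.Product using (Σ; ∃; _×_; _,_; proj₁; proj₂)
open import Data.Sum as Sum using (_⊎_; inj₁; inj₂)
open import Data.Unit using (tt) renaming (⊤ to Unit)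
open import Data.Vec using (tabulate; []; _∷_)
open import Data.Vec.Properties using (lookup∘tabulate; []=⇒lookup; lookup⇒[]=)
open import Function using (_∘_; id)
open import Function.Bundles using (_⇔_; mk⇔)
open import Induction.WellFounded using (Acc; acc)
open import Level using (0ℓ)
open import Relation.Binary.Construct.Closure.ReflexiveTransitive as Star using (Star; ε; _◅_; _◅◅_)
open import Relation.Binary.Definitions using (Symmetric; Reflexive) renaming (Decidable to Decidable₂)
open import Relation.Binary.PropositionalEquality using (_≡_; _≢_; refl; sym; trans; cong; subst; subst₂)
open import Relation.Nullary using (¬_; yes; no; does; contradiction)
open import Relation.Nullary.Decidable using (_×-dec_; _⊎-dec_; _→-dec_; ¬?; dec-true; decidable-stable; ¬¬-excluded-middle)
open import Relation.Unary using (Pred; Decidable)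

-- Finite subsets, pairs and decidability under double negation

module _ {n : ℕ} {P : Pred (Fin n) 0ℓ} (P? : Decidable P) where

  comprehension : Subset n
  comprehension = tabulate (does ∘ P?)

  ∈-comprehension⁺ : ∀ {x} → P x → x ∈ comprehension
  ∈-comprehension⁺ {x} Px =
    lookup⇒[]= x _ (trans (lookup∘tabulate _ x) (dec-true (P? x) Px))

  ∈-comprehension⁻ : ∀ {x} → x ∈ comprehension → P x
  ∈-comprehension⁻ {x} x∈
    with P? x | trans (sym (lookup∘tabulate (does ∘ P?) x)) ([]=⇒lookup x∈)
  ... | yes Px | _  = Px
  ... | no _   | ()

∈-pair⁻ : ∀ {n} {u v z : Fin n} → z ∈ ⁅ u ⁆ ∪ ⁅ v ⁆ → z ≡ u ⊎ z ≡ v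
∈-pair⁻ z∈ = Sum.map (x∈⁅y⁆⇒x≡y _) (x∈⁅y⁆⇒x≡y _) (x∈p∪q⁻ _ _ z∈)

1<∣pair∣ : ∀ {n} {u v : Fin n} → u ≢ v → 1 < ∣ ⁅ u ⁆ ∪ ⁅ v ⁆ ∣
1<∣pair∣ {u = u} {v} u≢v = subst (_< ∣ ⁅ u ⁆ ∪ ⁅ v ⁆ ∣) (∣⁅x⁆∣≡1 u) (p⊂q⇒∣p∣<∣q∣
  (p⊆p∪q _ , v , x∈p∪q⁺ (inj₂ (x∈⁅x⁆ v)) , λ v∈ → u≢v (sym (x∈⁅y⁆⇒x≡y _ v∈))))

-- Excluded middle holds under double negation at each of finitely many points. This allows
-- membership in a connected component to be decided while a decidable goal is being proved.
¬¬-decidable : ∀ {n} (P : Pred (Fin n) 0ℓ) → ¬ ¬ Decidable P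
¬¬-decidable {zero}  P k = k λ ()
¬¬-decidable {suc n} P k = ¬¬-excluded-middle λ P0? →
  ¬¬-decidable (P ∘ suc) λ P? → k λ { zero → P0? ; (suc i) → P? i }

-- Closed neighbourhoods, cliques and simplicial vertices

module Neighbourhoods {n : ℕ} (G : Graph n) where
  open Graph G public

  infix 4 _≃_ _≃?_
  -- Membership in the closed neighbourhood N[u]. Being reflexive, it spares cliques any
  -- distinctness condition, and its negation means distinct and non-adjacent.
  _≃_ : Fin n → Fin n → Set
  u ≃ v = u ≡ v ⊎ u ~ v

  _≃?_ : Decidable₂ _≃_
  u ≃? v = (u ≟ v) ⊎-dec (u ~? v)

  ≃-sym : Symmetric _≃_
  ≃-sym = Sum.map sym ~-sym

  ≃-refl : Reflexive _≃_
  ≃-refl = inj₁ refl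

  Clique : Subset n → Set
  Clique K = ∀ {u v} → u ∈ K → v ∈ K → u ≃ v

  Simplicial : Subset n → Fin n → Set
  Simplicial W s = ∀ u v → u ∈ W → v ∈ W → s ≃ u → s ≃ v → u ≃ v

  simplicial? : ∀ W → Decidable (Simplicial W)
  simplicial? W s = all? λ u → all? λ v →
    (u ∈? W) →-dec ((v ∈? W) →-dec ((s ≃? u) →-dec ((s ≃? v) →-dec (u ≃? v))))

-- Induced paths and cycles

module InducedPaths {n : ℕ} (G : Graph n) (P : Pred (Fin n) 0ℓ) where
  open Neighbourhoods G

  Step : Fin n → Fin n → Set
  Step a b = P a × P b × a ~ b

  -- The vertices of the path, in order, are u ∷ l.
  data InducedPath : (u : Fin n) (l : List (Fin n)) (v : Fin n) → Set where
    [_]  : ∀ {u} → P u → InducedPath u [] u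
    cons : ∀ {u w l v} → P u → u ~ w → All (λ z → ¬ (u ≃ z)) l →
           InducedPath w l v → InducedPath u (w ∷ l) v

  -- Enter the path at the last vertex that u meets.
  prepend : ∀ {u w l v} → P u → Any (u ≃_) (w ∷ l) → InducedPath w l v →
            ∃ λ l′ → InducedPath u l′ v
  prepend {u} {l = l} Pu near p with Any.any? (u ≃?_) l
  prepend Pu near (cons _ _ _ p) | yes near′ = prepend Pu near′ p
  prepend Pu (here (inj₁ refl)) p | no far = _ , p
  prepend Pu (here (inj₂ u~w)) p | no far = _ , cons Pu u~w (¬Any⇒All¬ _ far) p
  prepend Pu (there near) p | no far = contradiction near far

  walk⇒inducedPath : ∀ {u v} → P v → Star Step u v → ∃ λ l → InducedPath u l v
  walk⇒inducedPath Pv ε = [] , [ Pv ]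
  walk⇒inducedPath Pv ((Pu , _ , u~w) ◅ ws) =
    prepend Pu (here (inj₂ u~w)) (proj₂ (walk⇒inducedPath Pv ws))

  path-edge : ∀ {u l v} → InducedPath u l v → ∀ i j → toℕ j ≡ suc (toℕ i) →
              lookup (u ∷ l) i ~ lookup (u ∷ l) j
  path-edge [ _ ] zero zero ()
  path-edge (cons _ u~w _ p) zero (suc zero) _ = u~w
  path-edge (cons _ _ _ p) (suc i) (suc j) eq = path-edge p i j (ℕ.suc-injective eq)

  path-chordless : ∀ {u l v} → InducedPath u l v → ∀ i j →
                   lookup (u ∷ l) i ~ lookup (u ∷ l) j →
                   toℕ j ≡ suc (toℕ i) ⊎ toℕ i ≡ suc (toℕ j)
  path-chordless _ zero zero e = contradiction e (irrefl _)
  path-chordless (cons _ _ _ _) zero (suc zero) e = inj₁ refl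
  path-chordless (cons _ _ far _) zero (suc (suc j)) e =
    contradiction (inj₂ e) (All.lookup far (∈-lookup j))
  path-chordless (cons _ _ _ _) (suc zero) zero e = inj₂ refl
  path-chordless (cons _ _ far _) (suc (suc i)) zero e =
    contradiction (inj₂ (~-sym e)) (All.lookup far (∈-lookup i))
  path-chordless (cons _ _ _ p) (suc i) (suc j) e =
    Sum.map (cong suc) (cong suc) (path-chordless p i j e)

  -- The condition `¬ (u ≃ z)` in `cons` excludes repetitions together with chords.
  path-injective : ∀ {u l v} → InducedPath u l v → ∀ i j →
                   lookup (u ∷ l) i ≡ lookup (u ∷ l) j → i ≡ j
  path-injective _ zero zero _ = refl
  path-injective (cons _ u~w _ _) zero (suc zero) refl = contradiction u~w (irrefl _)
  path-injective (cons _ _ far _) zero (suc (suc j)) eq =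
    contradiction (inj₁ eq) (All.lookup far (∈-lookup j))
  path-injective (cons _ u~w _ _) (suc zero) zero refl = contradiction u~w (irrefl _)
  path-injective (cons _ _ far _) (suc (suc i)) zero eq =
    contradiction (inj₁ (sym eq)) (All.lookup far (∈-lookup i))
  path-injective (cons _ _ _ p) (suc i) (suc j) eq = cong suc (path-injective p i j eq)

  path-last : ∀ {u l v} → InducedPath u l v → ∀ i → toℕ i ≡ length l →
              lookup (u ∷ l) i ≡ v
  path-last [ _ ] zero _ = refl
  path-last (cons _ _ _ p) (suc i) eq = path-last p i (ℕ.suc-injective eq)

_∖⟨_,_⟩ : ∀ {n} → Graph n → Fin n → Fin n → Graph n
G ∖⟨ u , v ⟩ = record
  { _~_    = λ a b → a ~ b × ¬ (a ≡ u × b ≡ v) × ¬ (a ≡ v × b ≡ u)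
  ; ~-sym  = λ (e , p , q) → ~-sym e , (λ (x , y) → q (y , x)) , (λ (x , y) → p (y , x))
  ; irrefl = λ a (e , _) → irrefl a e
  ; _~?_   = λ a b → (a ~? b) ×-dec (¬? ((a ≟ u) ×-dec (b ≟ v)) ×-dec ¬? ((a ≟ v) ×-dec (b ≟ u)))
  }
  where open Graph G

module _ {n : ℕ} (G : Graph n) (P : Pred (Fin n) 0ℓ) {u v : Fin n} where
  open Graph G
  open InducedPaths (G ∖⟨ u , v ⟩) P

  -- The path is induced in G - uv, so the only further edge that G can have between its vertices is
  -- uv, which is the closing edge of the cycle and no chord.
  closePath : ∀ {l} → u ~ v → InducedPath u l v → 2 ≤ length l →
              Σ (Cycle G (suc (length l))) Induced
  closePath {l} u~v p 2≤l = cycle , induced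
    where
    c : Fin (suc (length l)) → Fin n
    c = lookup (u ∷ l)

    c-first : ∀ i → toℕ i ≡ 0 → c i ≡ u
    c-first zero _ = refl

    first : ∀ i → c i ≡ u → toℕ i ≡ 0
    first i eq = cong toℕ (path-injective p i zero eq)

    last : ∀ i → c i ≡ v → toℕ i ≡ length l
    last i eq = trans (cong toℕ (path-injective p i (fromℕ _) (trans eq (sym c-last)))) (toℕ-fromℕ _)
      where
      c-last : c (fromℕ _) ≡ v
      c-last = path-last p (fromℕ _) (toℕ-fromℕ _)

    edge : ∀ i j → Next i j → c i ~ c j
    edge i j (inj₁ eq) = proj₁ (path-edge p i j eq)
    edge i j (inj₂ (eq , z)) =
      subst₂ _~_ (sym (path-last p i (ℕ.suc-injective eq))) (sym (c-first j z)) (~-sym u~v)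

    cycle : Cycle G (suc (length l))
    cycle = record
      { 3≤k    = s≤s 2≤l
      ; vertex = c
      ; inj    = path-injective p _ _
      ; edges  = λ i j → λ { (inj₁ nx) → edge i j nx ; (inj₂ nx) → ~-sym (edge j i nx) }
      }

    induced : Induced cycle
    induced i j e with (c i ≟ u) ×-dec (c j ≟ v) | (c i ≟ v) ×-dec (c j ≟ u)
    ... | yes (i≡ , j≡) | _ = inj₂ (inj₂ (cong suc (last j j≡) , first i i≡))
    ... | no _ | yes (i≡ , j≡) = inj₁ (inj₂ (cong suc (last i i≡) , first j j≡))
    ... | no x | no y = Sum.map inj₁ inj₁ (path-chordless p i j (e , x , y))

  -- An induced path from `u` to `v` in G - uv has at least two edges, since `u` and `v` differ and
  -- their edge is deleted. Exactly two edges give a triangle, whose apex is returned so that it can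
  -- be excluded separately; more edges give an induced cycle of length at least four.
  closeWalk : u ~ v → P v → Star Step u v →
              (∃ λ k → 4 ≤ k × Σ (Cycle G k) Induced) ⊎
              (Cycle G 3 × ∃ λ w → P w × u ~ w × w ~ v)
  closeWalk u~v Pv ws with walk⇒inducedPath Pv ws
  ... | _ , [ _ ] = contradiction u~v (irrefl _)
  ... | _ , cons _ (_ , uv , _) _ [ _ ] = contradiction (refl , refl) uv
  ... | _ , p@(cons _ (u~w , _) _ (cons Pw (w~v , _) _ [ _ ])) =
    inj₂ (proj₁ (closePath u~v p (s≤s (s≤s z≤n))) , _ , Pw , u~w , w~v)
  ... | _ , p@(cons _ _ _ (cons _ _ _ (cons _ _ _ _))) =
    inj₁ (_ , s≤s (s≤s (s≤s (s≤s z≤n))) , closePath u~v p (s≤s (s≤s z≤n)))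

acyclic⇒bridge : ∀ {m} (T : Graph m) → (∀ k → ¬ Cycle T k) → ∀ {u v} → Graph._~_ T u v →
                 ¬ Star (Graph._~_ (T ∖⟨ u , v ⟩)) u v
acyclic⇒bridge T acyclic u~v ws
  with closeWalk T (λ _ → Unit) u~v tt (Star.map (λ e → tt , tt , e) ws)
... | inj₁ (k , _ , C , _) = acyclic k C
... | inj₂ (C , _)         = acyclic 3 C

-- Clique bags force chordality

-- The recursion returns from the end of the walk, so the first member of `A` found is the last one
-- visited.
lastExit : ∀ {m} {R : Fin m → Fin m → Set} {A : Pred (Fin m) 0ℓ} → Decidable A →
           ∀ {s t} → Star R s t → ¬ A t →
           let Outside = Star (λ a b → R a b × ¬ A a × ¬ A b) in
           (¬ A s × Outside s t) ⊎
           (∃ λ a → ∃ λ x → A a × ¬ A x × R a x × Outside x t)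
lastExit A? ε ¬At = inj₁ (¬At , ε)
lastExit A? (r ◅ rs) ¬At with lastExit A? rs ¬At
... | inj₂ exit = inj₂ exit
... | inj₁ (¬Ax , out) with A? _
...   | yes As = inj₂ (_ , _ , As , ¬Ax , r , out)
...   | no ¬As = inj₁ (¬As , (r , ¬As , ¬Ax) ◅ out)

module _ {n : ℕ} (G : Graph n) (𝒯 : TreeDecomposition G) where
  open Neighbourhoods G using (_≃_; Clique)
  open TreeDecomposition 𝒯

  -- Walk from c₀ to c₂ through the bags of c₁, and let ax be the edge by which the walk leaves
  -- the bags of c₀ for good.  The bag of a contains none of c₂, …, cₖ₋₁, so going round the
  -- cycle the other way joins x to a without the edge ax, which is a bridge.
  cliqueBags⇒chordal : (∀ t → Clique (bag t)) → Chordal G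
  cliqueBags⇒chordal clique (suc (suc (suc (suc k)))) (s≤s (s≤s (s≤s (s≤s _)))) C induced =
    goal (lastExit (λ t → c i₀ ∈? bag t) (subtree (c i₁) t₀₁ t₁₂ c₁∈t₀₁ c₁∈t₁₂)
                   (λ c₀∈ → c₀≄c₂ (clique _ c₀∈ c₂∈t₁₂)))
    where
    K = suc (suc (suc (suc k)))
    open Cycle C using (inj) renaming (vertex to c; edges to c-edges)

    i₀ i₁ i₂ iₗ : Fin K
    i₀ = zero
    i₁ = suc zero
    i₂ = suc (suc zero)
    iₗ = fromℕ _

    apart : ∀ {i j} → i ≢ j → ¬ Consecutive i j → ¬ (c i ≃ c j)
    apart i≢j _ (inj₁ eq) = i≢j (inj eq)
    apart _ ¬con (inj₂ e) = ¬con (induced _ _ e)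

    c₀≄c₂ : ¬ (c i₀ ≃ c i₂)
    c₀≄c₂ = apart (λ ()) λ
      { (inj₁ (inj₁ ())) ; (inj₁ (inj₂ (_ , ()))) ; (inj₂ (inj₁ ())) ; (inj₂ (inj₂ (() , _))) }

    c₁≄c≥₃ : ∀ {l} (j : Fin K) → toℕ j ≡ suc (suc (suc l)) → ¬ (c i₁ ≃ c j)
    c₁≄c≥₃ zero ()
    c₁≄c≥₃ (suc zero) ()
    c₁≄c≥₃ (suc (suc zero)) ()
    c₁≄c≥₃ (suc (suc (suc j))) _ = apart (λ ()) λ
      { (inj₁ (inj₁ ())) ; (inj₁ (inj₂ (() , _))) ; (inj₂ (inj₁ ())) ; (inj₂ (inj₂ (_ , ()))) }

    shared : ∀ i j → Next i j → ∃ λ t → c i ∈ bag t × c j ∈ bag t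
    shared i j nx = edges _ _ (c-edges i j (inj₁ nx))

    e₀₁ = shared i₀ i₁ (inj₁ refl)
    t₀₁ = proj₁ e₀₁
    c₁∈t₀₁ = proj₂ (proj₂ e₀₁)
    e₁₂ = shared i₁ i₂ (inj₁ refl)
    t₁₂ = proj₁ e₁₂
    c₁∈t₁₂ = proj₁ (proj₂ e₁₂)
    c₂∈t₁₂ = proj₂ (proj₂ e₁₂)

    module _ {a x : Fin m} (c₀∈a : c i₀ ∈ bag a) (c₀∉x : c i₀ ∉ bag x) (c₁∈a : c i₁ ∈ bag a) where

      Link : Fin m → Fin m → Set
      Link = Star (Graph._~_ (tree ∖⟨ a , x ⟩))

      -- A walk through the bags of `u` can cross the edge ax only if `u` lies in both bags.
      link : ∀ {u} → ¬ (u ∈ bag a × u ∈ bag x) → ∀ {s t} → u ∈ bag s → u ∈ bag t → Link s t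
      link not-both u∈s u∈t = Star.map
        (λ (p , q , e) → e , (λ { (refl , refl) → not-both (p , q) })
                           , (λ { (refl , refl) → not-both (q , p) }))
        (subtree _ _ _ u∈s u∈t)

      -- The clique at `a` contains `c i₀` and `c i₁`. The former excludes `c i₂`; the latter
      -- excludes every later vertex, including the last one, which is adjacent to `c i₀`.
      avoids : ∀ l j → toℕ j ≡ suc (suc l) → c j ∉ bag a
      avoids zero    j eq cj∈a with refl ← toℕ-injective {i = j} {i₂} eq = c₀≄c₂ (clique _ c₀∈a cj∈a)
      avoids (suc l) j eq cj∈a = c₁≄c≥₃ j eq (clique _ c₁∈a cj∈a)

      -- Descends along the cycle to `c i₂`, changing from the bags of one vertex to those of its
      -- predecessor at a bag that they share.
      round : ∀ l j → toℕ j ≡ suc (suc l) → ∀ {t} → c j ∈ bag t → Link t t₁₂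
      round zero j eq cj∈t with refl ← toℕ-injective {i = j} {i₂} eq =
        link (avoids zero j eq ∘ proj₁) cj∈t c₂∈t₁₂
      round (suc l) j eq cj∈t =
        link (avoids (suc l) j eq ∘ proj₁) cj∈t (proj₂ (proj₂ e)) ◅◅ round l i i≡ (proj₁ (proj₂ e))
        where
        i<K : suc (suc l) < K
        i<K = <-trans (n<1+n _) (subst (_< K) eq (toℕ<n j))
        i = fromℕ< i<K
        i≡ = toℕ-fromℕ< i<K
        e = shared i j (inj₁ (trans eq (cong suc (sym i≡))))

      a⇝t₁₂ : Link a t₁₂
      -- The first leg runs through bags of `c i₀`, which is absent from the bag of `x`, to a bag
      -- shared with the last vertex of the cycle.
      a⇝t₁₂ = link (c₀∉x ∘ proj₂) c₀∈a (proj₂ (proj₂ e)) ◅◅ round _ iₗ (toℕ-fromℕ _) (proj₁ (proj₂ e))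
        where e = shared iₗ i₀ (inj₂ (cong suc (toℕ-fromℕ _) , refl))

    goal : _ → _
    goal (inj₁ (c₀∉t₀₁ , _)) = c₀∉t₀₁ (proj₁ (proj₂ e₀₁))
    goal (inj₂ (a , x , c₀∈a , c₀∉x , (c₁∈a , _ , a~x) , out)) =
      -- The tail of the walk after `x` never visits `a`, whose bag contains `c i₀`. Its reverse
      -- therefore completes a walk from `a` to `x` that avoids the edge ax.
      acyclic⇒bridge tree (IsTree.acyclic isTree) a~x
        (a⇝t₁₂ c₀∈a c₀∉x c₁∈a ◅◅ Star.reverse (Graph.~-sym (tree ∖⟨ a , x ⟩)) (Star.map
          (λ ((_ , _ , e) , p , q) → e , (λ { (refl , _) → p c₀∈a }) , (λ { (_ , refl) → q c₀∈a }))
          out))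

-- Trees with an added leaf

leafGraph : ∀ {m} → Graph m → Fin m → Graph (suc m)
leafGraph {m} T t = record { _~_ = _~′_ ; ~-sym = λ {i} {j} → ~′-sym i j ; irrefl = ~′-irrefl ; _~?_ = _~′?_ }
  where
  open Graph T
  _~′_ : Fin (suc m) → Fin (suc m) → Set
  zero  ~′ zero  = ⊥₀
  zero  ~′ suc j = j ≡ t
  suc i ~′ zero  = i ≡ t
  suc i ~′ suc j = i ~ j

  ~′-sym : ∀ i j → i ~′ j → j ~′ i
  ~′-sym zero    (suc j) e = e
  ~′-sym (suc i) zero    e = e
  ~′-sym (suc i) (suc j) e = ~-sym e

  ~′-irrefl : ∀ i → ¬ (i ~′ i)
  ~′-irrefl (suc i) = irrefl i

  _~′?_ : Decidable₂ _~′_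
  zero  ~′? zero  = no λ ()
  zero  ~′? suc j = j ≟ t
  suc i ~′? zero  = i ≟ t
  suc i ~′? suc j = i ~? j

next : ∀ {k} (i : Fin k) → ∃ λ j → Next i j
next {suc k} i with suc (toℕ i) ℕ.<? suc k
... | yes lt = fromℕ< lt , inj₁ (toℕ-fromℕ< lt)
... | no ≮k  = zero , inj₂ (ℕ.≤-antisym (toℕ<n i) (ℕ.≮⇒≥ ≮k) , refl)

previous : ∀ {k} (i : Fin k) → ∃ λ j → Next j i
previous {suc k} zero    = fromℕ k , inj₂ (cong suc (toℕ-fromℕ k) , refl)
previous {suc k} (suc i) = inject₁ i , inj₁ (cong suc (sym (toℕ-inject₁ i)))

-- Without a wrap-around an index would exceed itself by two; one wrap-around forces `k` to be 2,
-- and two force it to be 1.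
next-asym : ∀ {k} {i j : Fin k} → 3 ≤ k → Next i j → ¬ Next j i
next-asym _ (inj₁ p) (inj₁ q) =
  ℕ.m≢1+n+m _ {1} (trans q (cong suc p))
next-asym {k} 3≤k (inj₁ p) (inj₂ (q , r)) =
  <⇒≱ 3≤k (≤-reflexive (trans (sym q) (cong suc (trans p (cong suc r)))))
next-asym 3≤k (inj₂ (p , q)) (inj₁ r) =
  <⇒≱ 3≤k (≤-reflexive (trans (sym p) (cong suc (trans r (cong suc q)))))
next-asym 3≤k (inj₂ (p , q)) (inj₂ (r , s)) =
  <⇒≱ 3≤k (≤-trans (≤-reflexive (trans (sym r) (cong suc q))) (s≤s z≤n))

leafTree : ∀ {m} {T : Graph m} (t : Fin m) → IsTree T → IsTree (leafGraph T t)
leafTree {m} {T} t isTree = record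
  { nonempty  = zero
  ; connected = connected′
  ; acyclic   = acyclic′
  }
  where
  open IsTree isTree
  T′ = leafGraph T t

  lift : ∀ {i j} → Star (Graph._~_ T) i j → Star (Graph._~_ T′) (suc i) (suc j)
  lift = Star.gmap suc id

  connected′ : ∀ i j → Star (Graph._~_ T′) i j
  connected′ zero    zero    = ε
  connected′ zero    (suc j) = refl ◅ lift (connected t j)
  connected′ (suc i) zero    = lift (connected i t) ◅◅ (refl ◅ ε)
  connected′ (suc i) (suc j) = lift (connected i j)

  leaf-neighbour : ∀ {i j} → i ≡ zero → Graph._~_ T′ i j → j ≡ suc t
  leaf-neighbour {j = suc j} refl refl = refl

  acyclic′ : ∀ k → ¬ Cycle T′ k
  acyclic′ k C = acyclic k record
    { 3≤k    = 3≤k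
    ; vertex = λ i → proj₁ (old i)
    ; inj    = λ {i} {j} eq → inj (trans (proj₂ (old i)) (trans (cong suc eq) (sym (proj₂ (old j)))))
    ; edges  = λ i j con → subst₂ (Graph._~_ T′) (proj₂ (old i)) (proj₂ (old j)) (edges i j con)
    }
    where
    open Cycle C

    -- The predecessor and the successor of the leaf on the cycle would both be its only neighbour
    -- `suc t`, hence would coincide.
    misses-leaf : ∀ i → vertex i ≢ zero
    misses-leaf i eq with next i | previous i
    ... | q , i→q | p , p→i = next-asym 3≤k i→q (subst (λ z → Next z i) p≡q p→i)
      where
      p≡q : p ≡ q
      p≡q = inj (trans (leaf-neighbour eq (edges i p (inj₂ p→i)))
                  (sym (leaf-neighbour eq (edges i q (inj₁ i→q)))))

    old : ∀ i → ∃ λ j → vertex i ≡ suc j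
    old i with vertex i in eq
    ... | zero  = contradiction eq (misses-leaf i)
    ... | suc j = j , refl

-- Clique trees of chordal graphs

module _ {n : ℕ} (G : Graph n) (chordal : Chordal G) where
  open Neighbourhoods G

  module ComponentOf (W : Subset n) (v w : Fin n) (v∈W : v ∈ W) (w∈W : w ∈ W) (v≄w : ¬ (v ≃ w)) where
    Far : Pred (Fin n) 0ℓ
    Far z = z ∈ W × ¬ (v ≃ z)

    FarStep : Fin n → Fin n → Set
    FarStep a b = Far a × Far b × a ~ b

    Component : Pred (Fin n) 0ℓ
    Component z = Far z × Star FarStep w z

    w∈C : Component w
    w∈C = (w∈W , v≄w) , ε

    -- N[C] within `W`, where C is the component of `w` in G[W] - N[v].
    Closed : Pred (Fin n) 0ℓ
    Closed z = z ∈ W × ∃ λ c → Component c × c ≃ z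

    component⊆closed : ∀ {z} → Component z → Closed z
    component⊆closed Cz = proj₁ (proj₁ Cz) , _ , Cz , ≃-refl

    closed-far⇒component : ∀ {z} → Closed z → ¬ (v ≃ z) → Component z
    closed-far⇒component (_ , _ , Cc , inj₁ refl) _ = Cc
    closed-far⇒component (z∈W , _ , (Fc , ws) , inj₂ c~z) v≄z =
      (z∈W , v≄z) , ws ◅◅ ((Fc , (z∈W , v≄z) , c~z) ◅ ε)

    v∉closed : ¬ Closed v
    v∉closed (_ , _ , ((_ , v≄c) , _) , c≃v) = v≄c (≃-sym c≃v)

    module _ {x y : Fin n} (Wx : Closed x) (Wy : Closed y) (v≃x : v ≃ x) (v≃y : v ≃ y) where
      -- A vertex of N[C] in N[v] is not `v`, which has no neighbour in C, and is not in C, which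
      -- avoids N[v]. Both relations are thus proper adjacencies.
      boundary-edge : ∀ {z} → Closed z → v ≃ z → v ~ z × ∃ λ c → Component c × c ~ z
      boundary-edge Wz (inj₁ refl) = contradiction Wz v∉closed
      boundary-edge (_ , _ , ((_ , v≄c) , _) , inj₁ refl) v≃z = contradiction v≃z v≄c
      boundary-edge (_ , c , Cc , inj₂ c~z) (inj₂ v~z) = v~z , c , Cc , c~z

      -- If `x` and `y` were non-adjacent, closing a walk through `y` and C with the edge vx would
      -- give a long induced cycle. The alternative, a triangle on vx, has no possible apex: `y` is
      -- not adjacent to `x`, and vertices of C are not adjacent to `v`.
      boundary-clique : x ≃ y
      boundary-clique with x ≃? y | boundary-edge Wx v≃x | boundary-edge Wy v≃y
      ... | yes x≃y | _ | _ = x≃y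
      ... | no x≄y | v~x , c , Cc , c~x | v~y , d , Cd , d~y =
        contradiction (closeWalk G OnCycle v~x isX walk) λ
          { (inj₁ (k , 4≤k , cyc , ind)) → chordal k 4≤k cyc ind
          ; (inj₂ (_ , _ , isV , v~v , _)) → irrefl _ v~v
          ; (inj₂ (_ , _ , isX , _ , x~x)) → irrefl _ x~x
          ; (inj₂ (_ , _ , isY , _ , y~x)) → x≄y (inj₂ (~-sym y~x))
          ; (inj₂ (_ , _ , inC ((_ , v≄z) , _) , v~z , _)) → v≄z (inj₂ v~z)
          }
        where
        data OnCycle : Pred (Fin n) 0ℓ where
          isV : OnCycle v
          isX : OnCycle x
          isY : OnCycle y
          inC : ∀ {z} → Component z → OnCycle z

        Avoiding : Fin n → Fin n → Set
        Avoiding a b = OnCycle a × OnCycle b × Graph._~_ (G ∖⟨ v , x ⟩) a b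

        off-v : ∀ {a b} → a ≢ v → b ≢ v → a ~ b → Graph._~_ (G ∖⟨ v , x ⟩) a b
        off-v a≢v b≢v a~b = a~b , a≢v ∘ proj₁ , b≢v ∘ proj₂

        component≢v : ∀ {z} → Component z → z ≢ v
        component≢v ((_ , v≄z) , _) refl = v≄z ≃-refl

        ~v⇒≢v : ∀ {z} → v ~ z → z ≢ v
        ~v⇒≢v v~v refl = irrefl _ v~v

        inside : ∀ {a b} → Component a → Star FarStep a b → Star Avoiding a b
        inside Ca ε = ε
        inside Ca@(Fa , ws) (e@(_ , Fb , a~b) ◅ es) =
          (inC Ca , inC Cb , off-v (component≢v Ca) (component≢v Cb) a~b) ◅ inside Cb es
          where Cb = Fb , ws ◅◅ (e ◅ ε)

        walk : Star Avoiding v x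
        walk =
          (isV , isY , v~y , (λ { (_ , refl) → x≄y ≃-refl }) , (λ { (refl , _) → irrefl _ v~x }))
          ◅ (isY , inC Cd , off-v (~v⇒≢v v~y) (component≢v Cd) (~-sym d~y))
          ◅ (inside Cd (Star.reverse (λ (Fa , Fb , e) → Fb , Fa , ~-sym e) (proj₂ Cd))
             ◅◅ inside w∈C (proj₂ Cc)
             ◅◅ ((inC Cc , isX , off-v (component≢v Cc) (~v⇒≢v v~x) c~x) ◅ ε))

  -- Let C be a component of G[W] − N[v].  Chordality makes N(C) ∩ N(v) a clique, since two
  -- non-adjacent vertices in it lie on an induced cycle through v and C.  A vertex of C that is
  -- simplicial in N[C] is simplicial in W, and the induction hypothesis for N[C], applied
  -- to a non-universal vertex taken in N(v) if possible, gives one.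
  simplicial-outside : ∀ W → Acc _⊂_ W → ∀ v w → v ∈ W → w ∈ W → ¬ (v ≃ w) →
                       ∃ λ s → s ∈ W × ¬ (v ≃ s) × Simplicial W s
  simplicial-outside W (acc rec) v w v∈W w∈W v≄w =
    -- The goal is decidable, so `Component` may be assumed decidable.
    decidable-stable (any? λ s → (s ∈? W) ×-dec (¬? (v ≃? s) ×-dec simplicial? W s))
      (λ none → ¬¬-decidable Component λ C? → none (search C?))
    where
    open ComponentOf W v w v∈W w∈W v≄w

    module _ (C? : Decidable Component) where
      closed? : Decidable Closed
      closed? z = (z ∈? W) ×-dec any? λ c → C? c ×-dec (c ≃? z)

      W′ : Subset n
      W′ = comprehension closed?

      ∈W′⁺ : ∀ {z} → Closed z → z ∈ W′
      ∈W′⁺ = ∈-comprehension⁺ closed?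

      ∈W′⁻ : ∀ {z} → z ∈ W′ → Closed z
      ∈W′⁻ = ∈-comprehension⁻ closed?

      W′⊂W : W′ ⊂ W
      W′⊂W = proj₁ ∘ ∈W′⁻ , v , v∈W , v∉closed ∘ ∈W′⁻

      -- Such an `s` lies in C, so its neighbours in `W` all lie in N[C], where it is known to be
      -- simplicial.
      extend : ∀ {s} → s ∈ W′ → ¬ (v ≃ s) → Simplicial W′ s →
               ∃ λ s → s ∈ W × ¬ (v ≃ s) × Simplicial W s
      extend {s} s∈W′ v≄s simp = s , proj₁ (∈W′⁻ s∈W′) , v≄s , λ a b a∈W b∈W s≃a s≃b →
        simp a b (near a∈W s≃a) (near b∈W s≃b) s≃a s≃b
        where
        near : ∀ {a} → a ∈ W → s ≃ a → a ∈ W′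
        near a∈W s≃a = ∈W′⁺ (a∈W , s , closed-far⇒component (∈W′⁻ s∈W′) v≄s , s≃a)

      search : ∃ λ s → s ∈ W × ¬ (v ≃ s) × Simplicial W s
      search with any? (λ a → any? λ b → ((a ∈? W′) ×-dec (b ∈? W′) ×-dec ¬? (a ≃? b)) ×-dec (v ≃? a))
      -- Here `a` is in N(v). Were `s` in N(v) too, `boundary-clique` would make it adjacent to `a`.
      ... | yes (a , b , (a∈ , b∈ , a≄b) , v≃a) =
        let s , s∈ , a≄s , simp = simplicial-outside W′ (rec W′⊂W) a b a∈ b∈ a≄b
        in extend s∈ (λ v≃s → a≄s (boundary-clique (∈W′⁻ a∈) (∈W′⁻ s∈) v≃a v≃s)) simp
      ... | no universal with any? (λ a → any? λ b → (a ∈? W′) ×-dec (b ∈? W′) ×-dec ¬? (a ≃? b))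
      -- Now every vertex of N[C] in N(v) is adjacent to all others in N[C], whereas `s` is not
      -- adjacent to `a`.
      ...   | yes (a , b , a∈ , b∈ , a≄b) =
        let s , s∈ , a≄s , simp = simplicial-outside W′ (rec W′⊂W) a b a∈ b∈ a≄b
        in extend s∈ (λ v≃s → universal (s , a , (s∈ , a∈ , a≄s ∘ ≃-sym) , v≃s)) simp
      -- N[C] is a clique, so any vertex of C serves.
      ...   | no clique = extend (∈W′⁺ (component⊆closed w∈C)) v≄w λ a b a∈ b∈ _ _ →
        decidable-stable (a ≃? b) λ a≄b → clique (a , b , a∈ , b∈ , a≄b)

  simplicial-exists : ∀ W {w} → w ∈ W → ∃ λ s → s ∈ W × Simplicial W s
  simplicial-exists W {w} w∈W with any? (λ a → any? λ b → (a ∈? W) ×-dec (b ∈? W) ×-dec ¬? (a ≃? b))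
  ... | yes (a , b , a∈ , b∈ , a≄b) =
    let s , s∈ , _ , simp = simplicial-outside W (⊂-wellFounded W) a b a∈ b∈ a≄b in s , s∈ , simp
  ... | no clique = w , w∈W , λ a b a∈ b∈ _ _ →
    decidable-stable (a ≃? b) λ a≄b → clique (a , b , a∈ , b∈ , a≄b)

  -- The field clique⊆bag is what tells the induction where to attach the next leaf.
  record CliqueTree (W : Subset n) : Set₁ where
    field
      {m}      : ℕ
      tree     : Graph m
      isTree   : IsTree tree
      bag      : Fin m → Subset n
      bag⊆W    : ∀ t → bag t ⊆ W
      clique   : ∀ t → Clique (bag t)
      clique⊆bag : ∀ K → K ⊆ W → Clique K → ∃ λ t → K ⊆ bag t
      subtree  : ∀ u → ConnectedOn tree (λ t → u ∈ bag t)

  emptyCliqueTree : ∀ {W} → (∀ {w} → w ∉ W) → CliqueTree W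
  emptyCliqueTree ∉W = record
    { tree    = TreeDecomposition.tree (trivialDecomposition G)
    ; isTree  = TreeDecomposition.isTree (trivialDecomposition G)
    ; bag     = λ _ → ⊥
    ; bag⊆W   = λ _ x∈ → contradiction x∈ ∉⊥
    ; clique  = λ _ u∈ → contradiction u∈ ∉⊥
    ; clique⊆bag = λ K K⊆W _ → zero , λ x∈K → contradiction (K⊆W x∈K) ∉W
    ; subtree = λ _ _ _ u∈ → contradiction u∈ ∉⊥
    }

  module AddLeaf {W : Subset n} {s : Fin n} (s∈W : s ∈ W) (simp : Simplicial W s) where
    rest? : Decidable (λ z → z ∈ W × z ≢ s)
    rest? z = (z ∈? W) ×-dec ¬? (z ≟ s)

    rest : Subset n
    rest = comprehension rest?

    rest⊂W : rest ⊂ W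
    rest⊂W = proj₁ ∘ ∈-comprehension⁻ rest? , s , s∈W , λ s∈ → proj₂ (∈-comprehension⁻ rest? s∈) refl

    near? : Decidable (λ z → z ∈ W × s ≃ z)
    near? z = (z ∈? W) ×-dec (s ≃? z)

    near : Subset n
    near = comprehension near?

    open-near? : Decidable (λ z → z ∈ W × s ~ z)
    open-near? z = (z ∈? W) ×-dec (s ~? z)

    open-near : Subset n
    open-near = comprehension open-near?

    near-clique : Clique near
    near-clique u∈ v∈ with ∈-comprehension⁻ near? u∈ | ∈-comprehension⁻ near? v∈
    ... | u∈W , s≃u | v∈W , s≃v = simp _ _ u∈W v∈W s≃u s≃v

    open-near⊆rest : open-near ⊆ rest
    open-near⊆rest x∈ with ∈-comprehension⁻ open-near? x∈
    ... | x∈W , s~x = ∈-comprehension⁺ rest? (x∈W , λ { refl → irrefl _ s~x })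

    open-near-clique : Clique open-near
    open-near-clique u∈ v∈ with ∈-comprehension⁻ open-near? u∈ | ∈-comprehension⁻ open-near? v∈
    ... | u∈W , s~u | v∈W , s~v = simp _ _ u∈W v∈W (inj₂ s~u) (inj₂ s~v)

    -- The leaf hangs on a node whose bag contains the clique N(s) of W - s.
    addLeaf : CliqueTree rest → CliqueTree W
    addLeaf 𝒯 = record
      { tree    = leafGraph tree t
      ; isTree  = leafTree t isTree
      ; bag     = bag′
      ; bag⊆W   = bag′⊆W
      ; clique  = clique′
      ; clique⊆bag = clique⊆bag′
      ; subtree = subtree′
      }
      where
      open CliqueTree 𝒯
      attach = clique⊆bag open-near open-near⊆rest open-near-clique
      t = proj₁ attach

      bag′ : Fin (suc m) → Subset n
      bag′ zero    = near
      bag′ (suc i) = bag i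

      bag′⊆W : ∀ i → bag′ i ⊆ W
      bag′⊆W zero    x∈ = proj₁ (∈-comprehension⁻ near? x∈)
      bag′⊆W (suc i) x∈ = proj₁ (∈-comprehension⁻ rest? (bag⊆W i x∈))

      clique′ : ∀ i → Clique (bag′ i)
      clique′ zero    = near-clique
      clique′ (suc i) = clique i

      -- A clique through `s` lies in N[s], the bag of the leaf; any other lies in W - s.
      clique⊆bag′ : ∀ K → K ⊆ W → Clique K → ∃ λ i → K ⊆ bag′ i
      clique⊆bag′ K K⊆W K-clique with s ∈? K
      ... | yes s∈K = zero , λ x∈K → ∈-comprehension⁺ near? (K⊆W x∈K , K-clique s∈K x∈K)
      ... | no  s∉K =
        let i , K⊆ = clique⊆bag K (λ x∈K → ∈-comprehension⁺ rest? (K⊆W x∈K , λ { refl → s∉K x∈K })) K-clique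
        in suc i , K⊆

      module _ (u : Fin n) where
        Step′ : Fin (suc m) → Fin (suc m) → Set
        Step′ a b = u ∈ bag′ a × u ∈ bag′ b × Graph._~_ (leafGraph tree t) a b

        lift : ∀ {i j} → u ∈ bag i → u ∈ bag j → Star Step′ (suc i) (suc j)
        lift u∈i u∈j = Star.gmap suc id (subtree u _ _ u∈i u∈j)

        -- Old bags omit `s`, so `u` is a proper neighbour of `s`, and N(s) is contained in the bag
        -- of `t`.
        near∧bag⇒attached : ∀ {i} → u ∈ near → u ∈ bag i → u ∈ bag t
        near∧bag⇒attached u∈near u∈i
          with ∈-comprehension⁻ near? u∈near | ∈-comprehension⁻ rest? (bag⊆W _ u∈i)
        ... | _   , inj₁ s≡u | _ , u≢s = contradiction (sym s≡u) u≢s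
        ... | u∈W , inj₂ s~u | _       = proj₂ attach (∈-comprehension⁺ open-near? (u∈W , s~u))

        subtree′ : ∀ i j → u ∈ bag′ i → u ∈ bag′ j → Star Step′ i j
        subtree′ zero    zero    _  _  = ε
        subtree′ zero    (suc j) u∈ u∈j =
          let u∈t = near∧bag⇒attached u∈ u∈j in (u∈ , u∈t , refl) ◅ lift u∈t u∈j
        subtree′ (suc i) zero    u∈i u∈ =
          let u∈t = near∧bag⇒attached u∈ u∈i in lift u∈i u∈t ◅◅ ((u∈t , u∈ , refl) ◅ ε)
        subtree′ (suc i) (suc j) u∈i u∈j = lift u∈i u∈j

  cliqueTree : ∀ W → Acc _⊂_ W → CliqueTree W
  cliqueTree W (acc rec) with nonempty? W
  ... | no empty = emptyCliqueTree λ w∈W → empty (_ , w∈W)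
  ... | yes (_ , w∈W) = addLeaf (cliqueTree rest (rec rest⊂W))
    where
    s = simplicial-exists W w∈W
    open AddLeaf (proj₁ (proj₂ s)) (proj₂ (proj₂ s))

  -- Vertices and edges are cliques, so `clique⊆bag` covers both; a vertex is treated as the
  -- degenerate pair with equal entries.
  cliqueDecomposition : Σ (TreeDecomposition G) λ 𝒯 → ∀ t → Clique (TreeDecomposition.bag 𝒯 t)
  cliqueDecomposition = record
    { tree    = tree
    ; isTree  = isTree
    ; bag     = bag
    ; covers  = λ u → let t , ⊆t = pair (≃-refl {u}) in t , ⊆t (x∈p∪q⁺ (inj₁ (x∈⁅x⁆ u)))
    ; edges   = λ u v u~v → let t , ⊆t = pair (inj₂ u~v) in
                  t , ⊆t (x∈p∪q⁺ (inj₁ (x∈⁅x⁆ u))) , ⊆t (x∈p∪q⁺ (inj₂ (x∈⁅x⁆ v)))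
    ; subtree = subtree
    } , clique
    where
    open CliqueTree (cliqueTree ⊤ (⊂-wellFounded ⊤))
    pair-clique : ∀ {u v} → u ≃ v → Clique (⁅ u ⁆ ∪ ⁅ v ⁆)
    pair-clique u≃v x∈ y∈ with ∈-pair⁻ x∈ | ∈-pair⁻ y∈
    ... | inj₁ refl | inj₁ refl = ≃-refl
    ... | inj₁ refl | inj₂ refl = u≃v
    ... | inj₂ refl | inj₁ refl = ≃-sym u≃v
    ... | inj₂ refl | inj₂ refl = ≃-refl

    pair : ∀ {u v} → u ≃ v → ∃ λ t → ⁅ u ⁆ ∪ ⁅ v ⁆ ⊆ bag t
    pair u≃v = clique⊆bag _ (λ _ → ∈⊤) (pair-clique u≃v)

-- Bags of independence number at most one

∈-subsets : ∀ {n} (S : Subset n) → S ∈ˡ subsets n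
∈-subsets []          = here refl
∈-subsets (false ∷ S) = ∈-++⁺ˡ (∈-map⁺ _ (∈-subsets S))
∈-subsets (true  ∷ S) = ∈-++⁺ʳ _ (∈-map⁺ _ (∈-subsets S))

module _ {n : ℕ} (G : Graph n) where
  open Neighbourhoods G

  independent⊆clique⇒∣∣≤1 : ∀ {X S} → Clique X → S ⊆ X → Independent G S → ∣ S ∣ ≤ 1
  independent⊆clique⇒∣∣≤1 {X} {S} clique S⊆X indep with nonempty? S
  ... | no empty rewrite Empty-unique empty = ≤-trans (≤-reflexive (∣⊥∣≡0 n)) z≤n
  ... | yes (x , x∈S) = ≤-trans (p⊆q⇒∣p∣≤∣q∣ S⊆⁅x⁆) (≤-reflexive (∣⁅x⁆∣≡1 x))
    where
    S⊆⁅x⁆ : S ⊆ ⁅ x ⁆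
    S⊆⁅x⁆ y∈S with clique (S⊆X x∈S) (S⊆X y∈S)
    ... | inj₁ refl = x∈⁅x⁆ x
    ... | inj₂ x~y  = contradiction x~y (indep _ x∈S _ y∈S)

  clique⇒α≤1 : ∀ {X} → Clique X → α[ G , X ] ≤ 1
  -- The argument `z≤n` bounds the default value 0 of the maximum.
  clique⇒α≤1 {X} clique = max≤v⁺ z≤n (All-map⁺ (All.map
    (λ (S⊆X , indep) → independent⊆clique⇒∣∣≤1 clique S⊆X indep)
    (all-filter (λ S → (S ⊆? X) ×-dec independent? G S) (subsets n))))

  independent⇒∣∣≤α : ∀ {X S} → S ⊆ X → Independent G S → ∣ S ∣ ≤ α[ G , X ]
  independent⇒∣∣≤α {X} {S} S⊆X indep = All.lookup (xs≤max 0 _) (∈-map⁺ ∣_∣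
    (∈-filter⁺ (λ S → (S ⊆? X) ×-dec independent? G S) (∈-subsets S) (S⊆X , indep)))

  pair-independent : ∀ {u v} → ¬ (u ≃ v) → Independent G (⁅ u ⁆ ∪ ⁅ v ⁆)
  pair-independent u≄v a a∈ b b∈ a~b with ∈-pair⁻ a∈ | ∈-pair⁻ b∈
  ... | inj₁ refl | inj₁ refl = irrefl _ a~b
  ... | inj₁ refl | inj₂ refl = u≄v (inj₂ a~b)
  ... | inj₂ refl | inj₁ refl = u≄v (inj₂ (~-sym a~b))
  ... | inj₂ refl | inj₂ refl = irrefl _ a~b

  -- Two distinct non-adjacent vertices of `X` would form an independent set of size two.
  α≤1⇒clique : ∀ {X} → α[ G , X ] ≤ 1 → Clique X
  α≤1⇒clique {X} α≤1 {u} {v} u∈X v∈X = decidable-stable (u ≃? v) λ u≄v →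
    <⇒≱ (1<∣pair∣ (u≄v ∘ inj₁)) (≤-trans (independent⇒∣∣≤α pair⊆X (pair-independent u≄v)) α≤1)
    where
    pair⊆X : ⁅ u ⁆ ∪ ⁅ v ⁆ ⊆ X
    pair⊆X z∈ = Sum.[ (λ { refl → u∈X }) , (λ { refl → v∈X }) ] (∈-pair⁻ z∈)

  module _ (𝒯 : TreeDecomposition G) where
    open TreeDecomposition 𝒯

    cliqueBags⇒α≤1 : (∀ t → Clique (bag t)) → α 𝒯 ≤ 1
    cliqueBags⇒α≤1 clique = max≤v⁺ z≤n (All-map⁺ (All.universal (λ t → clique⇒α≤1 (clique t)) (allFin m)))

    α≤1⇒cliqueBags : α 𝒯 ≤ 1 → ∀ t → Clique (bag t)
    α≤1⇒cliqueBags α≤1 t = α≤1⇒clique (≤-trans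
      (All.lookup (xs≤max 0 _) (∈-map⁺ (λ t → α[ G , bag t ]) (∈-allFin t))) α≤1)

theorem3p3 : ∀ (n : ℕ) (G : Graph n) (tree-α : ℕ) → IsTreeα G tree-α →
    (tree-α ≤ 1) ⇔ Chordal G
theorem3p3 n G tree-α isTreeα = mk⇔ chordal bound
  where
  open IsMinimum isTreeα

  chordal : tree-α ≤ 1 → Chordal G
  chordal ≤1 with attained
  ... | 𝒯 , refl = cliqueBags⇒chordal G 𝒯 (α≤1⇒cliqueBags G 𝒯 ≤1)

  bound : Chordal G → tree-α ≤ 1
  bound ch with cliqueDecomposition G ch
  -- Minimality compares `tree-α` with the independence number of the clique decomposition.
  ... | 𝒯 , clique = ≤-trans (least _ (𝒯 , refl)) (cliqueBags⇒α≤1 G 𝒯 clique)
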